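{- Let $t$ be a weak-head normalising pure $\lambda$-term, let $\Phi_t$ be a principally typed derivation of $t$ in system $\mathcal{V}$, and let $r$ be a redex occurrence of $t$ with $r\in\mathrm{toc}(\Phi_t)$. Then $r$ is a weak-head needed redex in $t$.
   Context: Pure $\lambda$-terms, occurrences (words over $\{0,1\}$, $0$ = function part/abstraction body, $1$ = argument), redex occurrences $p$ with $t|_p=(\lambda x.s)v$, standard residuals. WHNF: $\lambda x.t$ or $x\,t_1\cdots t_n$; $t$ is weak-head normalising if $t\rightarrow_\beta^* t'$ for some WHNF $t'$; a redex is weak-head needed if every reduction sequence from $t$ to a WHNF contracts it or one of its residuals. System $\mathcal{V}$: types $\tau::=\mathtt{a}\mid\alpha\mid\mathcal{M}\to\tau$ ($\alpha$ type variables, $\mathcal{M}$ finite multisets of types); rules (ax) $x:[\tau]\vdash x:\tau$; (val) $\emptyset\vdash\lambda x.t:\mathtt{a}$; ($\to$i) from $\Gamma\vdash t:\tau$ infer $\Gamma\setminus x\vdash\lambda x.t:\Gamma(x)\to\tau$; ($\to$e) from $\Gamma\vdash t:[\sigma_i]_{i\in I}\to\tau$ and $(\Delta_i\vdash u:\sigma_i)_{i\in I}$ infer $\Gamma+\sum_i\Delta_i\vdash t\,u:\tau$. Typed occurrences $\mathrm{toc}(\Phi)$: $\{\epsilon\}$ for (ax),(val); $\{\epsilon\}\cup0\cdot\mathrm{toc}(\Phi_t)$ for ($\to$i); $\{\epsilon\}\cup0\cdot\mathrm{toc}(\Phi_t)\cup\bigcup_i1\cdot\mathrm{toc}(\Phi_u^i)$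 for ($\to$e). The multiset of subderivations of $\Phi$ at $p\in\mathrm{toc}(\Phi)$ is defined by following $0$ into the (unique) left/body premise and $1$ into all argument premises. Typed substitution $x\{\!\{(\Phi_u^i)_{i\in I}\}\!\}\Phi_t$ (defined when $\Phi_t(x)=[\mathrm{type}(\Phi_u^i)]_{i\in I}$, all $\Phi_u^i$ with subject $u$): an (ax) on $x$ becomes the unique $\Phi_u^i$; an (ax) on $y\ne x$ is unchanged; (val) on $\lambda y.s$ becomes (val) on $\lambda y.s\{x:=u\}$; ($\to$i) recurses into its premise; ($\to$e) on $r\,s$ splits $I$ (nondeterministically) into parts matching the types assigned to $x$ by each premise, recurses, and replaces the argument term by $s\{x:=u\}$. Reduction of derivations: if $\Phi$ has subject $t$, $t$ reduces to $t'$ by contracting redex occurrence $r$, and $m$ is the longest prefix of $r$ belonging to $\mathrm{toc}(\Phi)$, then $\Phi\rightarrow_\beta\Phi'$ where $\Phi'$ is obtained by rewriting every subderivation of $\Phi$ at $m$: if $m=r$, a subderivation ending in ($\to$e) with left premise a ($\to$i) on $\lambda x.s$ with premise $\Phi_s$ and argument premises $(\Phi_u^i)$ is replaced by some typed substitution $x\{\!\{(\Phi_u^i)\}\!\}\Phi_s$; otherwise (the redex lies in an untyped argument of a ($\to$e) or in the body of a (val)) only the subject of that subderivation is reduced. A derivation $\Phi$ of $t$ is normal if no redex occurrence of $t$ is in $\mathrm{toc}(\Phi)$. A derivation of $\Gamma\vdash t:\tau$ with $t$ in WHNF is normal principally typed if either $t=x\,t_1\cdots t_n$, $\tau$ is a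 type variable $\alpha$ and $\Gamma=\{x:[[\,]\to\cdots\to[\,]\to\alpha]\}$ (with $n$ empty multisets), or $t=\lambda x.t'$, $\Gamma$ is empty and $\tau=\mathtt{a}$. For weak-head normalising $t$, a derivation $\Phi_t$ of $t$ is principally typed if whenever $\Phi_t\rightarrow_\beta^*\Phi_{t'}$ with $t'$ a WHNF reachable from $t$, $\Phi_{t'}$ is normal principally typed. -}

module Defs where

open import Data.Nat using (ℕ; zero; suc; pred; _<ᵇ_; _≡ᵇ_)
open import Data.Bool using (Bool; true; false; if_then_else_)
open import Data.List using (List; []; _∷_; _++_; [_]; map)
open import Data.List.Relation.Unary.All using (All)
open import Data.List.Relation.Unary.Any using (Any)
open import Data.List.Relation.Binary.Pointwise using (Pointwise)
open import Data.List.Relation.Binary.Permutation.Propositional using (_↭_)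
open import Data.Maybe using (Maybe; just; nothing)
open import Data.Product using (Σ; _×_; ∃; ∃-syntax; _,_)
open import Relation.Binary.PropositionalEquality using (_≡_; _≢_)
open import Relation.Nullary using (¬_)

-- Pure λ-terms (de Bruijn indices)

data Tm : Set where
  var : ℕ → Tm
  lam : Tm → Tm
  app : Tm → Tm → Tm

shiftIx : ℕ → ℕ → ℕ
shiftIx c i = if i <ᵇ c then i else suc i

↑ : ℕ → Tm → Tm
↑ c (var i)   = var (shiftIx c i)
↑ c (lam t)   = lam (↑ (suc c) t)
↑ c (app t s) = app (↑ c t) (↑ c s)

decIx : ℕ → ℕ → ℕ
decIx k i = if i <ᵇ k then i else pred i

substVar : ℕ → Tm → ℕ → Tm
substVar k u i = if i ≡ᵇ k then u else var (decIx k i)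

-- sub k u t : capture-avoiding t{k := u}, removing binder k
sub : ℕ → Tm → Tm → Tm
sub k u (var i)   = substVar k u i
sub k u (lam t)   = lam (sub (suc k) (↑ 0 u) t)
sub k u (app t s) = app (sub k u t) (sub k u s)

-- Occurrences: 0 = function part / abstraction body, 1 = argument

data Dir : Set where
  d0 d1 : Dir

Occ : Set
Occ = List Dir

_at_ : Tm → Occ → Maybe Tm
t         at []       = just t
lam t     at (d0 ∷ p) = t at p
app t u   at (d0 ∷ p) = t at p
app t u   at (d1 ∷ p) = u at p
_         at _        = nothing

IsRedexOcc : Tm → Occ → Set
IsRedexOcc t p = ∃[ s ] ∃[ v ] (t at p ≡ just (app (lam s) v))

data Contract : Tm → Occ → Tm → Set where
  here  : ∀ {s v} → Contract (app (lam s) v) [] (sub 0 v s)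
  inLam : ∀ {t p t'} → Contract t p t' → Contract (lam t) (d0 ∷ p) (lam t')
  inFun : ∀ {t u p t'} → Contract t p t' → Contract (app t u) (d0 ∷ p) (app t' u)
  inArg : ∀ {t u p u'} → Contract u p u' → Contract (app t u) (d1 ∷ p) (app t u')

data Steps : Tm → Tm → Set where
  done : ∀ {t} → Steps t t
  step : ∀ {t t' u} (p : Occ) → Contract t p t' → Steps t' u → Steps t u

-- x t₁ ⋯ tₙ : Spine t x n
data Spine : Tm → ℕ → ℕ → Set where
  sp-var : ∀ {x} → Spine (var x) x 0
  sp-app : ∀ {t u x n} → Spine t x n → Spine (app t u) x (suc n)

data WHNF : Tm → Set where
  whnf-lam : ∀ {t} → WHNF (lam t)
  whnf-neu : ∀ {t x n} → Spine t x n → WHNF t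

WeakHeadNormalising : Tm → Set
WeakHeadNormalising t = ∃[ t' ] (Steps t t' × WHNF t')

data FreeOcc : ℕ → Tm → Occ → Set where
  fo-var : ∀ {k} → FreeOcc k (var k) []
  fo-lam : ∀ {k t o} → FreeOcc (suc k) t o → FreeOcc k (lam t) (d0 ∷ o)
  fo-fun : ∀ {k t u o} → FreeOcc k t o → FreeOcc k (app t u) (d0 ∷ o)
  fo-arg : ∀ {k t u o} → FreeOcc k u o → FreeOcc k (app t u) (d1 ∷ o)

data Residual (t : Tm) (p : Occ) : Occ → Occ → Set where
  res-out  : ∀ {r} → ¬ (∃[ q ] (r ≡ p ++ q)) → Residual t p r r
  res-body : ∀ {q} → Residual t p (p ++ d0 ∷ d0 ∷ q) (p ++ q)
  res-arg  : ∀ {s v o q} → t at p ≡ just (app (lam s) v) → FreeOcc 0 s o →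
             Residual t p (p ++ d1 ∷ q) (p ++ o ++ q)

data Hits : ∀ {t u} → Occ → Steps t u → Set where
  hit-now   : ∀ {t t' u p} {c : Contract t p t'} {σ : Steps t' u} → Hits p (step p c σ)
  hit-later : ∀ {t t' u p r r'} {c : Contract t p t'} {σ : Steps t' u} →
              Residual t p r r' → Hits r' σ → Hits r (step p c σ)

WeakHeadNeeded : Tm → Occ → Set
WeakHeadNeeded t r = ∀ {u} (σ : Steps t u) → WHNF u → Hits r σ

-- System V: types (multisets as lists, compared up to deep permutation)

data Ty : Set where
  ⋆a  : Ty
  tv  : ℕ → Ty
  _⇒_ : List Ty → Ty → Ty

mutual
  data _≈T_ : Ty → Ty → Set where
    ≈a : ⋆a ≈T ⋆a
    ≈v : ∀ {n} → tv n ≈T tv n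
    ≈⇒ : ∀ {M N τ σ} → M ≈M N → τ ≈T σ → (M ⇒ τ) ≈T (N ⇒ σ)

  data _≈M_ : List Ty → List Ty → Set where
    []≈ : [] ≈M []
    ∷≈  : ∀ {τ σ M N₁ N₂} → τ ≈T σ → M ≈M (N₁ ++ N₂) → (τ ∷ M) ≈M (N₁ ++ σ ∷ N₂)

data Der : Tm → Set where
  ax   : (i : ℕ) → Ty → Der (var i)                          -- x_i : [τ] ⊢ x_i : τ
  val  : (b : Tm) → Der (lam b)                              -- ⊢ λ.b : a
  lamI : ∀ {t} → Der t → Der (lam t)
  appE : ∀ {t} → Der t → (u : Tm) → List (Der u) → Der (app t u)

Ctx : Set
Ctx = ℕ → List Ty

mutual
  ctx : ∀ {t} → Der t → Ctx
  ctx (ax i τ)        j = if j ≡ᵇ i then [ τ ] else []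
  ctx (val b)         j = []
  ctx (lamI Φ)        j = ctx Φ (suc j)
  ctx (appE Φ u Ψs)   j = ctx Φ j ++ ctxs Ψs j

  ctxs : ∀ {u} → List (Der u) → Ctx
  ctxs []       j = []
  ctxs (Ψ ∷ Ψs) j = ctx Ψ j ++ ctxs Ψs j

cod : Ty → Ty
cod (M ⇒ τ) = τ
cod _       = ⋆a

ty : ∀ {t} → Der t → Ty
ty (ax i τ)      = τ
ty (val b)       = ⋆a
ty (lamI Φ)      = ctx Φ 0 ⇒ ty Φ
ty (appE Φ u Ψs) = cod (ty Φ)

data Valid : ∀ {t} → Der t → Set where
  v-ax  : ∀ {i τ} → Valid (ax i τ)
  v-val : ∀ {b} → Valid (val b)
  v-lam : ∀ {t} {Φ : Der t} → Valid Φ → Valid (lamI Φ)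
  v-app : ∀ {t u M τ} {Φ : Der t} {Ψs : List (Der u)} →
          Valid Φ → ty Φ ≡ (M ⇒ τ) → M ≈M map ty Ψs → All Valid Ψs →
          Valid (appE Φ u Ψs)

data InToc : ∀ {t} → Der t → Occ → Set where
  toc-root : ∀ {t} {Φ : Der t} → InToc Φ []
  toc-lam  : ∀ {t p} {Φ : Der t} → InToc Φ p → InToc (lamI Φ) (d0 ∷ p)
  toc-fun  : ∀ {t u p} {Φ : Der t} {Ψs : List (Der u)} → InToc Φ p → InToc (appE Φ u Ψs) (d0 ∷ p)
  toc-arg  : ∀ {t u p} {Φ : Der t} {Ψs : List (Der u)} →
             Any (λ Ψ → InToc Ψ p) Ψs → InToc (appE Φ u Ψs) (d1 ∷ p)

mutual
  shiftD : ∀ {u} (c : ℕ) → Der u → Der (↑ c u)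
  shiftD c (ax i τ)      = ax (shiftIx c i) τ
  shiftD c (val b)       = val (↑ (suc c) b)
  shiftD c (lamI Φ)      = lamI (shiftD (suc c) Φ)
  shiftD c (appE Φ u Ψs) = appE (shiftD c Φ) (↑ c u) (shiftDs c Ψs)

  shiftDs : ∀ {u} (c : ℕ) → List (Der u) → List (Der (↑ c u))
  shiftDs c []       = []
  shiftDs c (Ψ ∷ Ψs) = shiftD c Ψ ∷ shiftDs c Ψs

-- typed substitution  x_k{{Ψs}}Φ  (nondeterministic splitting of Ψs)
mutual
  data TSubst : (k : ℕ) (u : Tm) → List (Der u) → ∀ {t t'} → Der t → Der t' → Set where
    ts-hit   : ∀ {k u τ} (Ψ : Der u) → ty Ψ ≈T τ → TSubst k u (Ψ ∷ []) (ax k τ) Ψ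
    ts-other : ∀ {k u i τ} → (i ≡ᵇ k) ≡ false → TSubst k u [] (ax i τ) (ax (decIx k i) τ)
    ts-val   : ∀ {k u} (b : Tm) → TSubst k u [] (val b) (val (sub (suc k) (↑ 0 u) b))
    ts-lam   : ∀ {k u Ψs t t'} {Φ : Der t} {Φ' : Der t'} →
               TSubst (suc k) (↑ 0 u) (shiftDs 0 Ψs) Φ Φ' → TSubst k u Ψs (lamI Φ) (lamI Φ')
    ts-app   : ∀ {k u Ψs Ψs₀ Ψs₁ t t' w} {Φ : Der t} {Φ' : Der t'}
                 {Χs : List (Der w)} {Χs' : List (Der (sub k u w))} →
               Ψs ↭ (Ψs₀ ++ Ψs₁) → TSubst k u Ψs₀ Φ Φ' → TSubstArgs k u Ψs₁ Χs Χs' →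
               TSubst k u Ψs (appE Φ w Χs) (appE Φ' (sub k u w) Χs')

  data TSubstArgs (k : ℕ) (u : Tm) : List (Der u) → ∀ {w} → List (Der w) → List (Der (sub k u w)) → Set where
    []  : ∀ {w} → TSubstArgs k u [] {w} [] []
    _∷_ : ∀ {w Ψs₁ Ψs₂} {Χ : Der w} {Χ' : Der (sub k u w)} {Χs Χs'} →
          TSubst k u Ψs₁ {w} {sub k u w} Χ Χ' → TSubstArgs k u Ψs₂ Χs Χs' →
          TSubstArgs k u (Ψs₁ ++ Ψs₂) (Χ ∷ Χs) (Χ' ∷ Χs')

data DRed : ∀ {t t'} → Der t → Occ → Der t' → Set where
  dr-β   : ∀ {s v t'} {Φs : Der s} {Ψs : List (Der v)} {Φ' : Der t'} →
           TSubst 0 v Ψs Φs Φ' → DRed (appE (lamI Φs) v Ψs) [] Φ'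
  dr-val : ∀ {b b' r} → Contract b r b' → DRed (val b) (d0 ∷ r) (val b')
  dr-lam : ∀ {t t' r} {Φ : Der t} {Φ' : Der t'} → DRed Φ r Φ' → DRed (lamI Φ) (d0 ∷ r) (lamI Φ')
  dr-fun : ∀ {t t' u r} {Φ : Der t} {Φ' : Der t'} {Ψs : List (Der u)} →
           DRed Φ r Φ' → DRed (appE Φ u Ψs) (d0 ∷ r) (appE Φ' u Ψs)
  dr-arg : ∀ {t u u' r} {Φ : Der t} {Ψs : List (Der u)} {Ψs' : List (Der u')} →
           Contract u r u' → Pointwise (λ Ψ Ψ' → DRed Ψ r Ψ') Ψs Ψs' →
           DRed (appE Φ u Ψs) (d1 ∷ r) (appE Φ u' Ψs')

DStep : ∀ {t t'} → Der t → Der t' → Set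
DStep {t} {t'} Φ Φ' = ∃[ r ] (Contract t r t' × DRed Φ r Φ')

data DSteps : ∀ {t t'} → Der t → Der t' → Set where
  d-done : ∀ {t} {Φ : Der t} → DSteps Φ Φ
  d-step : ∀ {t t' t''} {Φ : Der t} {Φ' : Der t'} {Φ'' : Der t''} →
           DStep Φ Φ' → DSteps Φ' Φ'' → DSteps Φ Φ''

arrows : ℕ → ℕ → Ty
arrows zero    α = tv α
arrows (suc n) α = [] ⇒ arrows n α

data NormalPrincipal : ∀ {t} → Der t → Set where
  np-neu : ∀ {t x n α} {Φ : Der t} → Spine t x n → ty Φ ≡ tv α →
           ctx Φ x ≈M [ arrows n α ] → (∀ y → y ≢ x → ctx Φ y ≡ []) → NormalPrincipal Φ
  np-lam : ∀ {b} {Φ : Der (lam b)} → ty Φ ≡ ⋆a → (∀ y → ctx Φ y ≡ []) → NormalPrincipal Φ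

PrincipallyTyped : ∀ {t} → Der t → Set
PrincipallyTyped Φ = ∀ {t'} (Φ' : Der t') → DSteps Φ Φ' → WHNF t' → NormalPrincipal Φ'

-- Contracting any redex of t turns Φ into a derivation Φ' of the reduct (subject
-- reduction, through typed substitution), and every residual of a redex typed in Φ is
-- typed in Φ'. Hence along a reduction to a WHNF either some residual of r is
-- contracted, or the final derivation still types a residual of r. The latter is
-- impossible: that derivation is normal principally typed, so the head variable of a
-- neutral WHNF has type [] → ⋯ → [] → α, every argument is untyped, and no redex is typed.
module Submission where

open import Defs
open import Data.Bool using (true; false)
open import Data.Empty using (⊥-elim)
open import Data.List using (List; []; _∷_; _++_; [_]; map)
open import Data.List.Properties using (++-assoc; ++-identityʳ; ≡-dec)
open import Data.List.Relation.Binary.Permutation.Propositional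
  using (_↭_; prep; swap; ↭-refl; ↭-sym; ↭-trans; ↭-reflexive)
open import Data.List.Relation.Binary.Permutation.Propositional.Properties
  using (++⁺ˡ; shifts; All-resp-↭; Any-resp-↭)
open import Data.List.Relation.Binary.Pointwise using (Pointwise; []; _∷_)
open import Data.List.Relation.Unary.All using (All; []; _∷_)
open import Data.List.Relation.Unary.All.Properties using (++⁻)
open import Data.List.Relation.Unary.Any using (Any; here; there)
open import Data.List.Relation.Unary.Any.Properties using () renaming (++⁻ to Any-++⁻)
open import Data.Maybe using (just)
open import Data.Nat using (ℕ; zero; suc; _<ᵇ_; _≡ᵇ_; _+_; _≟_)
open import Data.Nat.Properties using (+-suc; +-identityʳ)
open import Data.Product using (_×_; ∃-syntax; _,_; proj₂)
open import Data.Sum using (inj₁; inj₂)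
open import Relation.Binary.PropositionalEquality
  using (_≡_; _≢_; refl; sym; trans; cong; cong₂; subst)
open import Relation.Nullary using (¬_; Dec; yes; no)

-- Multisets of types up to deep reordering

data Remove {A : Set} : List A → A → List A → Set where
  here  : ∀ {x xs} → Remove (x ∷ xs) x xs
  there : ∀ {x y xs ys} → Remove xs y ys → Remove (x ∷ xs) y (x ∷ ys)

remove-middle : ∀ {A : Set} (N₁ : List A) {σ N₂} → Remove (N₁ ++ σ ∷ N₂) σ (N₁ ++ N₂)
remove-middle []       = here
remove-middle (x ∷ N₁) = there (remove-middle N₁)

remove-split : ∀ {A : Set} {N σ N'} → Remove {A} N σ N' →
               ∃[ N₁ ] ∃[ N₂ ] (N ≡ N₁ ++ σ ∷ N₂ × N' ≡ N₁ ++ N₂)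
remove-split (here {xs = xs}) = [] , xs , refl , refl
remove-split (there {x = x} s) with remove-split s
... | N₁ , N₂ , refl , refl = x ∷ N₁ , N₂ , refl , refl

remove-++ʳ : ∀ {A : Set} {N σ N'} (B : List A) → Remove N σ N' → Remove (N ++ B) σ (N' ++ B)
remove-++ʳ B here      = here
remove-++ʳ B (there s) = there (remove-++ʳ B s)

remove-swap : ∀ {A : Set} {P a P₀ b P₀'} → Remove {A} P a P₀ → Remove P₀ b P₀' →
              ∃[ P' ] (Remove P b P' × Remove P' a P₀')
remove-swap here       s₂         = _ , there s₂ , here
remove-swap (there s₁) here       = _ , here , s₁
remove-swap (there s₁) (there s₂) with remove-swap s₁ s₂
... | _ , s₁' , s₂' = _ , there s₁' , there s₂'

remove-map⁻ : ∀ {A B : Set} (f : A → B) {xs y ys} → Remove (map f xs) y ys →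
              ∃[ x ] ∃[ xs' ] (Remove xs x xs' × f x ≡ y × map f xs' ≡ ys)
remove-map⁻ f {x ∷ xs} here = x , xs , here , refl , refl
remove-map⁻ f {x ∷ xs} (there s) with remove-map⁻ f s
... | a , as , s' , refl , refl = a , x ∷ as , there s' , refl , refl

remove⇒↭ : ∀ {A : Set} {xs x xs'} → Remove {A} xs x xs' → xs ↭ (x ∷ xs')
remove⇒↭ here              = ↭-refl
remove⇒↭ (there {x = y} s) = ↭-trans (prep y (remove⇒↭ s)) (swap _ _ ↭-refl)

-- The frozen ≈M inserts on the right at an appended position N₁ ++ σ ∷ N₂, which
-- cannot be inverted by pattern matching; ≅ₘ records the position as a Remove instead.
infix 4 _≅_ _≅ₘ_

mutual
  data _≅_ : Ty → Ty → Set where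
    ≅a : ⋆a ≅ ⋆a
    ≅v : ∀ {n} → tv n ≅ tv n
    ≅⇒ : ∀ {M N τ σ} → M ≅ₘ N → τ ≅ σ → (M ⇒ τ) ≅ (N ⇒ σ)

  data _≅ₘ_ : List Ty → List Ty → Set where
    []   : [] ≅ₘ []
    cons : ∀ {τ σ M N N'} → τ ≅ σ → Remove N σ N' → M ≅ₘ N' → τ ∷ M ≅ₘ N

mutual
  ≈T⇒≅ : ∀ {τ σ} → τ ≈T σ → τ ≅ σ
  ≈T⇒≅ ≈a       = ≅a
  ≈T⇒≅ ≈v       = ≅v
  ≈T⇒≅ (≈⇒ m t) = ≅⇒ (≈M⇒≅ₘ m) (≈T⇒≅ t)

  ≈M⇒≅ₘ : ∀ {M N} → M ≈M N → M ≅ₘ N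
  ≈M⇒≅ₘ []≈               = []
  ≈M⇒≅ₘ (∷≈ {N₁ = N₁} t m) = cons (≈T⇒≅ t) (remove-middle N₁) (≈M⇒≅ₘ m)

mutual
  ≅⇒≈T : ∀ {τ σ} → τ ≅ σ → τ ≈T σ
  ≅⇒≈T ≅a       = ≈a
  ≅⇒≈T ≅v       = ≈v
  ≅⇒≈T (≅⇒ m t) = ≈⇒ (≅ₘ⇒≈M m) (≅⇒≈T t)

  ≅ₘ⇒≈M : ∀ {M N} → M ≅ₘ N → M ≈M N
  ≅ₘ⇒≈M []           = []≈
  ≅ₘ⇒≈M (cons t s m) with remove-split s
  ... | _ , _ , refl , refl = ∷≈ (≅⇒≈T t) (≅ₘ⇒≈M m)

mutual
  ≅-refl : ∀ τ → τ ≅ τ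
  ≅-refl ⋆a      = ≅a
  ≅-refl (tv _)  = ≅v
  ≅-refl (M ⇒ τ) = ≅⇒ (≅ₘ-refl M) (≅-refl τ)

  ≅ₘ-refl : ∀ M → M ≅ₘ M
  ≅ₘ-refl []      = []
  ≅ₘ-refl (τ ∷ M) = cons (≅-refl τ) here (≅ₘ-refl M)

≅ₘ-insert : ∀ {N σ N' τ M} → N' ≅ₘ M → σ ≅ τ → Remove N σ N' → N ≅ₘ τ ∷ M
≅ₘ-insert m              t here      = cons t here m
≅ₘ-insert (cons t' s m') t (there r) = cons t' (there s) (≅ₘ-insert m' t r)

mutual
  ≅-sym : ∀ {τ σ} → τ ≅ σ → σ ≅ τ
  ≅-sym ≅a       = ≅a
  ≅-sym ≅v       = ≅v
  ≅-sym (≅⇒ m t) = ≅⇒ (≅ₘ-sym m) (≅-sym t)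

  ≅ₘ-sym : ∀ {M N} → M ≅ₘ N → N ≅ₘ M
  ≅ₘ-sym []           = []
  ≅ₘ-sym (cons t s m) = ≅ₘ-insert (≅ₘ-sym m) (≅-sym t) s

≅ₘ-remove : ∀ {N P σ N'} → N ≅ₘ P → Remove N σ N' →
            ∃[ ρ ] ∃[ P' ] (Remove P ρ P' × σ ≅ ρ × N' ≅ₘ P')
≅ₘ-remove (cons t s m) here = _ , _ , s , t , m
≅ₘ-remove (cons t s m) (there r) with ≅ₘ-remove m r
... | ρ , _ , s₀ , t' , m' with remove-swap s s₀
... | P' , s₁ , s₂ = ρ , P' , s₁ , t' , cons t s₂ m'

mutual
  ≅-trans : ∀ {τ σ ρ} → τ ≅ σ → σ ≅ ρ → τ ≅ ρ
  ≅-trans ≅a       q          = q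
  ≅-trans ≅v       q          = q
  ≅-trans (≅⇒ m t) (≅⇒ m' t') = ≅⇒ (≅ₘ-trans m m') (≅-trans t t')

  ≅ₘ-trans : ∀ {M N P} → M ≅ₘ N → N ≅ₘ P → M ≅ₘ P
  ≅ₘ-trans []           q = q
  ≅ₘ-trans (cons t s m) q with ≅ₘ-remove q s
  ... | _ , _ , s' , t' , m' = cons (≅-trans t t') s' (≅ₘ-trans m m')

≅ₘ-++ : ∀ {A A' B B'} → A ≅ₘ A' → B ≅ₘ B' → A ++ B ≅ₘ A' ++ B'
≅ₘ-++ []                    q = q
≅ₘ-++ {B' = B'} (cons t s m) q = cons t (remove-++ʳ B' s) (≅ₘ-++ m q)

↭⇒≅ₘ : ∀ {A B} → A ↭ B → A ≅ₘ B
↭⇒≅ₘ {A} _↭_.refl    = ≅ₘ-refl A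
↭⇒≅ₘ (prep x p)       = cons (≅-refl x) here (↭⇒≅ₘ p)
↭⇒≅ₘ (swap x y p)     = cons (≅-refl x) (there here) (cons (≅-refl y) here (↭⇒≅ₘ p))
↭⇒≅ₘ (_↭_.trans p q)  = ≅ₘ-trans (↭⇒≅ₘ p) (↭⇒≅ₘ q)

≅ₘ-[]ʳ : ∀ {A} → A ≅ₘ [] → A ≡ []
≅ₘ-[]ʳ []             = refl
≅ₘ-[]ʳ (cons _ () _)

≅ₘ-[]ˡ : ∀ {A} → [] ≅ₘ A → A ≡ []
≅ₘ-[]ˡ [] = refl

≅-⇒-inv : ∀ {ρ M τ} → ρ ≅ M ⇒ τ → ∃[ M' ] ∃[ τ' ] (ρ ≡ M' ⇒ τ' × M' ≅ₘ M × τ' ≅ τ)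
≅-⇒-inv (≅⇒ m t) = _ , _ , refl , m , t

≅-cod : ∀ {τ σ} → τ ≅ σ → cod τ ≅ cod σ
≅-cod ≅a       = ≅a
≅-cod ≅v       = ≅a
≅-cod (≅⇒ _ t) = t

Pointwise⇒≅ₘ : ∀ {A B : Set} {f : A → Ty} {g : B → Ty} {xs ys} →
               Pointwise (λ x y → f x ≅ g y) xs ys → map f xs ≅ₘ map g ys
Pointwise⇒≅ₘ []      = []
Pointwise⇒≅ₘ (t ∷ p) = cons t here (Pointwise⇒≅ₘ p)

≡ᵇ-refl : ∀ k → (k ≡ᵇ k) ≡ true
≡ᵇ-refl zero    = refl
≡ᵇ-refl (suc k) = ≡ᵇ-refl k

≢⇒≡ᵇ-false : ∀ {i k} → i ≢ k → (i ≡ᵇ k) ≡ false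
≢⇒≡ᵇ-false {zero}  {zero}  i≢k = ⊥-elim (i≢k refl)
≢⇒≡ᵇ-false {zero}  {suc k} i≢k = refl
≢⇒≡ᵇ-false {suc i} {zero}  i≢k = refl
≢⇒≡ᵇ-false {suc i} {suc k} i≢k = ≢⇒≡ᵇ-false (λ e → i≢k (cong suc e))

≡ᵇ-sym : ∀ i k → (i ≡ᵇ k) ≡ (k ≡ᵇ i)
≡ᵇ-sym zero    zero    = refl
≡ᵇ-sym zero    (suc k) = refl
≡ᵇ-sym (suc i) zero    = refl
≡ᵇ-sym (suc i) (suc k) = ≡ᵇ-sym i k

shiftIx-suc : ∀ c j → shiftIx (suc c) (suc j) ≡ suc (shiftIx c j)
shiftIx-suc c j with j <ᵇ c
... | true  = refl
... | false = refl

shiftIx-≡ᵇ : ∀ c j i → (shiftIx c j ≡ᵇ shiftIx c i) ≡ (j ≡ᵇ i)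
shiftIx-≡ᵇ zero    j       i       = refl
shiftIx-≡ᵇ (suc c) zero    zero    = refl
shiftIx-≡ᵇ (suc c) zero    (suc i) rewrite shiftIx-suc c i = refl
shiftIx-≡ᵇ (suc c) (suc j) zero    rewrite shiftIx-suc c j = refl
shiftIx-≡ᵇ (suc c) (suc j) (suc i) rewrite shiftIx-suc c j | shiftIx-suc c i = shiftIx-≡ᵇ c j i

shiftIx-avoids-cutoff : ∀ c i → (c ≡ᵇ shiftIx c i) ≡ false
shiftIx-avoids-cutoff zero    i       = refl
shiftIx-avoids-cutoff (suc c) zero    = refl
shiftIx-avoids-cutoff (suc c) (suc i) rewrite shiftIx-suc c i = shiftIx-avoids-cutoff c i

decIx-suc : ∀ k i → (i ≡ᵇ k) ≡ false → decIx (suc k) (suc i) ≡ suc (decIx k i)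
decIx-suc zero    zero    ()
decIx-suc zero    (suc i) _ = refl
decIx-suc (suc k) zero    _ = refl
decIx-suc (suc k) (suc i) _ with i <ᵇ k
... | true  = refl
... | false = refl

shiftIx-decIx : ∀ k i → (i ≡ᵇ k) ≡ false → shiftIx k (decIx k i) ≡ i
shiftIx-decIx zero    zero    ()
shiftIx-decIx zero    (suc i) _ = refl
shiftIx-decIx (suc k) zero    _ = refl
shiftIx-decIx (suc k) (suc i) e rewrite decIx-suc k i e | shiftIx-suc k (decIx k i) =
  cong suc (shiftIx-decIx k i e)

decIx-≡ᵇ : ∀ k i j → (i ≡ᵇ k) ≡ false → (j ≡ᵇ decIx k i) ≡ (shiftIx k j ≡ᵇ i)
decIx-≡ᵇ k i j e =
  trans (sym (shiftIx-≡ᵇ k j (decIx k i))) (cong (shiftIx k j ≡ᵇ_) (shiftIx-decIx k i e))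

ctx-ax-self : ∀ k τ → ctx (ax k τ) k ≡ [ τ ]
ctx-ax-self k τ rewrite ≡ᵇ-refl k = refl

ctxs-++ : ∀ {u} (A B : List (Der u)) j → ctxs (A ++ B) j ≡ ctxs A j ++ ctxs B j
ctxs-++ []      B j = refl
ctxs-++ (Ψ ∷ A) B j rewrite ctxs-++ A B j = sym (++-assoc (ctx Ψ j) (ctxs A j) (ctxs B j))

ctxs-↭ : ∀ {u} {A B : List (Der u)} j → A ↭ B → ctxs A j ↭ ctxs B j
ctxs-↭ j _↭_.refl         = ↭-refl
ctxs-↭ j (prep Ψ p)       = ++⁺ˡ (ctx Ψ j) (ctxs-↭ j p)
ctxs-↭ j (swap Ψ Ψ' p)    =
  ↭-trans (shifts (ctx Ψ j) (ctx Ψ' j)) (++⁺ˡ (ctx Ψ' j) (++⁺ˡ (ctx Ψ j) (ctxs-↭ j p)))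
ctxs-↭ j (_↭_.trans p q)  = ↭-trans (ctxs-↭ j p) (ctxs-↭ j q)

mutual
  ctx-shiftD : ∀ {u} c (Φ : Der u) j → ctx (shiftD c Φ) (shiftIx c j) ≡ ctx Φ j
  ctx-shiftD c (ax i τ)      j rewrite shiftIx-≡ᵇ c j i = refl
  ctx-shiftD c (val b)       j = refl
  ctx-shiftD c (lamI Φ)      j rewrite sym (shiftIx-suc c j) = ctx-shiftD (suc c) Φ (suc j)
  ctx-shiftD c (appE Φ u Ψs) j = cong₂ _++_ (ctx-shiftD c Φ j) (ctxs-shiftDs c Ψs j)

  ctxs-shiftDs : ∀ {u} c (Ψs : List (Der u)) j → ctxs (shiftDs c Ψs) (shiftIx c j) ≡ ctxs Ψs j
  ctxs-shiftDs c []       j = refl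
  ctxs-shiftDs c (Ψ ∷ Ψs) j = cong₂ _++_ (ctx-shiftD c Ψ j) (ctxs-shiftDs c Ψs j)

mutual
  ctx-shiftD-cutoff : ∀ {u} c (Φ : Der u) → ctx (shiftD c Φ) c ≡ []
  ctx-shiftD-cutoff c (ax i τ) rewrite shiftIx-avoids-cutoff c i = refl
  ctx-shiftD-cutoff c (val b)       = refl
  ctx-shiftD-cutoff c (lamI Φ)      = ctx-shiftD-cutoff (suc c) Φ
  ctx-shiftD-cutoff c (appE Φ u Ψs) = cong₂ _++_ (ctx-shiftD-cutoff c Φ) (ctxs-shiftDs-cutoff c Ψs)

  ctxs-shiftDs-cutoff : ∀ {u} c (Ψs : List (Der u)) → ctxs (shiftDs c Ψs) c ≡ []
  ctxs-shiftDs-cutoff c []       = refl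
  ctxs-shiftDs-cutoff c (Ψ ∷ Ψs) = cong₂ _++_ (ctx-shiftD-cutoff c Ψ) (ctxs-shiftDs-cutoff c Ψs)

ty-shiftD : ∀ {u} c (Φ : Der u) → ty (shiftD c Φ) ≡ ty Φ
ty-shiftD c (ax i τ)      = refl
ty-shiftD c (val b)       = refl
ty-shiftD c (lamI Φ)      = cong₂ _⇒_ (ctx-shiftD (suc c) Φ 0) (ty-shiftD (suc c) Φ)
ty-shiftD c (appE Φ u Ψs) = cong cod (ty-shiftD c Φ)

map-ty-shiftDs : ∀ {u} c (Ψs : List (Der u)) → map ty (shiftDs c Ψs) ≡ map ty Ψs
map-ty-shiftDs c []       = refl
map-ty-shiftDs c (Ψ ∷ Ψs) = cong₂ _∷_ (ty-shiftD c Ψ) (map-ty-shiftDs c Ψs)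

mutual
  valid-shiftD : ∀ {u} c {Φ : Der u} → Valid Φ → Valid (shiftD c Φ)
  valid-shiftD c v-ax      = v-ax
  valid-shiftD c v-val     = v-val
  valid-shiftD c (v-lam V) = v-lam (valid-shiftD (suc c) V)
  valid-shiftD c (v-app {Φ = Φ} {Ψs = Ψs} V e m VΨs) =
    v-app (valid-shiftD c V) (trans (ty-shiftD c Φ) e)
          (subst (_ ≈M_) (sym (map-ty-shiftDs c Ψs)) m) (valid-shiftDs c VΨs)

  valid-shiftDs : ∀ {u} c {Ψs : List (Der u)} → All Valid Ψs → All Valid (shiftDs c Ψs)
  valid-shiftDs c []         = []
  valid-shiftDs c (V ∷ VΨs) = valid-shiftD c V ∷ valid-shiftDs c VΨs

mutual
  toc-shiftD : ∀ {u} c {Φ : Der u} {q} → InToc Φ q → InToc (shiftD c Φ) q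
  toc-shiftD c toc-root    = toc-root
  toc-shiftD c (toc-lam T) = toc-lam (toc-shiftD (suc c) T)
  toc-shiftD c (toc-fun T) = toc-fun (toc-shiftD c T)
  toc-shiftD c (toc-arg A) = toc-arg (toc-shiftDs c A)

  toc-shiftDs : ∀ {u} c {Ψs : List (Der u)} {q} →
                Any (λ Ψ → InToc Ψ q) Ψs → Any (λ Ψ → InToc Ψ q) (shiftDs c Ψs)
  toc-shiftDs c (here T)  = here (toc-shiftD c T)
  toc-shiftDs c (there A) = there (toc-shiftDs c A)

≅ₘ-map-ty-[] : ∀ {u} (Ψs : List (Der u)) → [] ≅ₘ map ty Ψs → Ψs ≡ []
≅ₘ-map-ty-[] []      _ = refl
≅ₘ-map-ty-[] (_ ∷ _) ()

≅ₘ-map-ty-[_] : ∀ {u} τ (Ψs : List (Der u)) → [ τ ] ≅ₘ map ty Ψs → ∃[ Ψ ] (Ψs ≡ [ Ψ ] × τ ≅ ty Ψ)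
≅ₘ-map-ty-[ τ ] Ψs (cons t s m) with ≅ₘ-[]ˡ m
... | refl with remove-map⁻ ty s
... | Ψ , [] , here , refl , _ = Ψ , refl , t

≅ₘ-map-ty-split : ∀ {u} A B (Ψs : List (Der u)) → A ++ B ≅ₘ map ty Ψs →
                  ∃[ Ψs₀ ] ∃[ Ψs₁ ] (Ψs ↭ Ψs₀ ++ Ψs₁ × A ≅ₘ map ty Ψs₀ × B ≅ₘ map ty Ψs₁)
≅ₘ-map-ty-split []      B Ψs m = [] , Ψs , ↭-refl , [] , m
≅ₘ-map-ty-split (a ∷ A) B Ψs (cons t s m) with remove-map⁻ ty s
... | Ψ , Ψs' , s' , refl , refl with ≅ₘ-map-ty-split A B Ψs' m
... | Ψs₀ , Ψs₁ , p , mA , mB =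
  Ψ ∷ Ψs₀ , Ψs₁ , ↭-trans (remove⇒↭ s') (prep Ψ p) , cons t here mA , mB

++-interchange-↭ : ∀ (a b c d : List Ty) → (a ++ b) ++ (c ++ d) ↭ (a ++ c) ++ (b ++ d)
++-interchange-↭ a b c d =
  ↭-trans (↭-reflexive (++-assoc a b (c ++ d)))
  (↭-trans (++⁺ˡ a (shifts b c)) (↭-reflexive (sym (++-assoc a c (b ++ d)))))

ctx-split-≅ₘ : ∀ {u} {A' B' : List Ty} A B {Ψs} (Ψs₀ Ψs₁ : List (Der u)) j → Ψs ↭ Ψs₀ ++ Ψs₁ →
               A' ≅ₘ A ++ ctxs Ψs₀ j → B' ≅ₘ B ++ ctxs Ψs₁ j → A' ++ B' ≅ₘ (A ++ B) ++ ctxs Ψs j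
ctx-split-≅ₘ A B Ψs₀ Ψs₁ j p c₀ c₁ =
  ≅ₘ-trans (≅ₘ-++ c₀ c₁) (↭⇒≅ₘ (↭-trans (++-interchange-↭ A (ctxs Ψs₀ j) B (ctxs Ψs₁ j))
    (++⁺ˡ (A ++ B) (↭-sym (↭-trans (ctxs-↭ j p) (↭-reflexive (ctxs-++ Ψs₀ Ψs₁ j)))))))

-- The target term is a parameter so that goals mention sub k u t and can be rewritten.
record Substitution (k : ℕ) (u : Tm) (Ψs : List (Der u)) {t : Tm} (Φ : Der t) (t' : Tm) : Set where
  constructor substitution
  field
    Φ'     : Der t'
    tsubst : TSubst k u Ψs Φ Φ'
    valid  : Valid Φ'
    ty-≅   : ty Φ' ≅ ty Φ
    ctx-≅  : ∀ j → ctx Φ' j ≅ₘ ctx Φ (shiftIx k j) ++ ctxs Ψs j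

record ArgsSubstitution (k : ℕ) (u : Tm) (Ψs : List (Der u)) {w : Tm} (Χs : List (Der w)) :
       Set where
  constructor args-substitution
  field
    Ψs'     : List (Der u)
    Χs'     : List (Der (sub k u w))
    perm    : Ψs ↭ Ψs'
    tsubsts : TSubstArgs k u Ψs' Χs Χs'
    valid   : All Valid Χs'
    ty-≅    : Pointwise (λ Χ' Χ → ty Χ' ≅ ty Χ) Χs' Χs
    ctx-≅   : ∀ j → ctxs Χs' j ≅ₘ ctxs Χs (shiftIx k j) ++ ctxs Ψs j

substitute-hit : ∀ k u τ (Ψ : Der u) → Valid Ψ → τ ≅ ty Ψ →
                 Substitution k u [ Ψ ] (ax k τ) (sub k u (var k))
substitute-hit k u τ Ψ V t rewrite ≡ᵇ-refl k =
  substitution Ψ (ts-hit Ψ (≅⇒≈T (≅-sym t))) V (≅-sym t) ctx≅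
  where
  ctx≅ : ∀ j → ctx Ψ j ≅ₘ ctx (ax k τ) (shiftIx k j) ++ (ctx Ψ j ++ [])
  ctx≅ j rewrite ≡ᵇ-sym (shiftIx k j) k | shiftIx-avoids-cutoff k j | ++-identityʳ (ctx Ψ j) =
    ≅ₘ-refl _

substitute-other : ∀ k u i τ → (i ≡ᵇ k) ≡ false → Substitution k u [] (ax i τ) (sub k u (var i))
substitute-other k u i τ e rewrite e = substitution _ (ts-other e) v-ax (≅-refl τ) ctx≅
  where
  ctx≅ : ∀ j → ctx (ax (decIx k i) τ) j ≅ₘ ctx (ax i τ) (shiftIx k j) ++ []
  ctx≅ j rewrite decIx-≡ᵇ k i j e | ++-identityʳ (ctx (ax i τ) (shiftIx k j)) = ≅ₘ-refl _

substitute-lam : ∀ {k u Ψs t} {Φ : Der t} →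
                 Substitution (suc k) (↑ 0 u) (shiftDs 0 Ψs) Φ (sub (suc k) (↑ 0 u) t) →
                 Substitution k u Ψs (lamI Φ) (sub k u (lam t))
substitute-lam {k} {Ψs = Ψs} {Φ = Φ} (substitution Φ' ts V t c) =
  substitution (lamI Φ') (ts-lam ts) (v-lam V) (≅⇒ ctx₀ t) ctx≅
  where
  ctx₀ : ctx Φ' 0 ≅ₘ ctx Φ 0
  ctx₀ = subst (ctx Φ' 0 ≅ₘ_)
           (trans (cong (ctx Φ 0 ++_) (ctxs-shiftDs-cutoff 0 Ψs)) (++-identityʳ (ctx Φ 0))) (c 0)
  ctx≅ : ∀ j → ctx Φ' (suc j) ≅ₘ ctx Φ (suc (shiftIx k j)) ++ ctxs Ψs j
  ctx≅ j = subst (ctx Φ' (suc j) ≅ₘ_)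
             (cong₂ _++_ (cong (ctx Φ) (shiftIx-suc k j)) (ctxs-shiftDs 0 Ψs j)) (c (suc j))

substitute-app : ∀ {k u Ψs Ψs₀ Ψs₁ t w M τ} {Φ : Der t} {Χs : List (Der w)} →
                 ty Φ ≡ M ⇒ τ → M ≈M map ty Χs → Ψs ↭ Ψs₀ ++ Ψs₁ →
                 Substitution k u Ψs₀ Φ (sub k u t) → ArgsSubstitution k u Ψs₁ Χs →
                 Substitution k u Ψs (appE Φ w Χs) (sub k u (app t w))
substitute-app {k} {Ψs₀ = Ψs₀} {Ψs₁} {Φ = Φ} {Χs} e mM p
               (substitution Φ' ts V t c) (args-substitution _ Χs' p₁ tss VΧs' ts' cs)
  with ≅-⇒-inv (subst (ty Φ' ≅_) e t)
... | _ , _ , e' , mM' , _ =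
  substitution (appE Φ' _ Χs') (ts-app (↭-trans p (++⁺ˡ _ p₁)) ts tss)
    (v-app V e' (≅ₘ⇒≈M (≅ₘ-trans mM' (≅ₘ-trans (≈M⇒≅ₘ mM) (≅ₘ-sym (Pointwise⇒≅ₘ ts'))))) VΧs')
    (≅-cod t)
    (λ j → ctx-split-≅ₘ (ctx Φ (shiftIx k j)) (ctxs Χs (shiftIx k j)) Ψs₀ Ψs₁ j p (c j) (cs j))

args-substitute-∷ : ∀ {k u Ψs Ψs₀ Ψs₁ w} {Χ : Der w} {Χs : List (Der w)} → Ψs ↭ Ψs₀ ++ Ψs₁ →
                    Substitution k u Ψs₀ Χ (sub k u w) → ArgsSubstitution k u Ψs₁ Χs →
                    ArgsSubstitution k u Ψs (Χ ∷ Χs)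
args-substitute-∷ {k} {Ψs₀ = Ψs₀} {Ψs₁} {Χ = Χ} {Χs} p
                  (substitution Χ' ts V t c) (args-substitution Ψs₁' Χs' p₁ tss VΧs' ts' cs) =
  args-substitution (Ψs₀ ++ Ψs₁') (Χ' ∷ Χs') (↭-trans p (++⁺ˡ Ψs₀ p₁))
    (ts ∷ tss) (V ∷ VΧs') (t ∷ ts')
    (λ j → ctx-split-≅ₘ (ctx Χ (shiftIx k j)) (ctxs Χs (shiftIx k j)) Ψs₀ Ψs₁ j p (c j) (cs j))

mutual
  substitute : ∀ k u (Ψs : List (Der u)) {t} (Φ : Der t) → Valid Φ → All Valid Ψs →
               ctx Φ k ≅ₘ map ty Ψs → Substitution k u Ψs Φ (sub k u t)
  substitute k u Ψs (ax i τ) _ VΨs m with i ≟ k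
  ... | yes refl with ≅ₘ-map-ty-[ τ ] Ψs (subst (_≅ₘ map ty Ψs) (ctx-ax-self k τ) m) | VΨs
  ...   | Ψ , refl , t | VΨ ∷ [] = substitute-hit k u τ Ψ VΨ t
  substitute k u Ψs (ax i τ) _ VΨs m | no i≢k
    rewrite ≢⇒≡ᵇ-false {k} {i} (λ e → i≢k (sym e)) with ≅ₘ-map-ty-[] Ψs m
  ... | refl = substitute-other k u i τ (≢⇒≡ᵇ-false i≢k)
  substitute k u Ψs (val b) _ _ m with ≅ₘ-map-ty-[] Ψs m
  ... | refl = substitution _ (ts-val b) v-val ≅a (λ _ → [])
  substitute k u Ψs (lamI Φ) (v-lam V) VΨs m =
    substitute-lam (substitute (suc k) (↑ 0 u) (shiftDs 0 Ψs) Φ V (valid-shiftDs 0 VΨs)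
                     (subst (ctx Φ (suc k) ≅ₘ_) (sym (map-ty-shiftDs 0 Ψs)) m))
  substitute k u Ψs (appE Φ w Χs) (v-app V e mM VΧs) VΨs m
    with ≅ₘ-map-ty-split (ctx Φ k) (ctxs Χs k) Ψs m
  ... | Ψs₀ , Ψs₁ , p , m₀ , m₁ with ++⁻ Ψs₀ (All-resp-↭ p VΨs)
  ... | VΨs₀ , VΨs₁ =
    substitute-app e mM p (substitute k u Ψs₀ Φ V VΨs₀ m₀) (substitutes k u Ψs₁ Χs VΧs VΨs₁ m₁)

  substitutes : ∀ k u (Ψs : List (Der u)) {w} (Χs : List (Der w)) → All Valid Χs → All Valid Ψs →
                ctxs Χs k ≅ₘ map ty Ψs → ArgsSubstitution k u Ψs Χs
  substitutes k u Ψs [] _ _ m with ≅ₘ-map-ty-[] Ψs m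
  ... | refl = args-substitution [] [] ↭-refl [] [] [] (λ _ → [])
  substitutes k u Ψs (Χ ∷ Χs) (VΧ ∷ VΧs) VΨs m with ≅ₘ-map-ty-split (ctx Χ k) (ctxs Χs k) Ψs m
  ... | Ψs₀ , Ψs₁ , p , m₀ , m₁ with ++⁻ Ψs₀ (All-resp-↭ p VΨs)
  ... | VΨs₀ , VΨs₁ =
    args-substitute-∷ p (substitute k u Ψs₀ Χ VΧ VΨs₀ m₀) (substitutes k u Ψs₁ Χs VΧs VΨs₁ m₁)

mutual
  tsubst-toc : ∀ {k u Ψs t t' r} {Φ : Der t} {Φ' : Der t'} → TSubst k u Ψs Φ Φ' →
               InToc Φ r → InToc Φ' r
  tsubst-toc ts                toc-root    = toc-root
  tsubst-toc (ts-lam ts)       (toc-lam T) = toc-lam (tsubst-toc ts T)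
  tsubst-toc (ts-app _ ts _)   (toc-fun T) = toc-fun (tsubst-toc ts T)
  tsubst-toc (ts-app _ _ tss) (toc-arg A) = toc-arg (tsubsts-toc tss A)

  tsubsts-toc : ∀ {k u Ψs w r} {Χs : List (Der w)} {Χs'} → TSubstArgs k u Ψs Χs Χs' →
                Any (λ Χ → InToc Χ r) Χs → Any (λ Χ → InToc Χ r) Χs'
  tsubsts-toc (ts ∷ _)   (here T)  = here (tsubst-toc ts T)
  tsubsts-toc (_ ∷ tss) (there A) = there (tsubsts-toc tss A)

mutual
  tsubst-toc-substituted : ∀ {k u Ψs t t' q} {Φ : Der t} {Φ' : Der t'} → TSubst k u Ψs Φ Φ' →
                           Any (λ Ψ → InToc Ψ q) Ψs → ∃[ o ] (FreeOcc k t o × InToc Φ' (o ++ q))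
  tsubst-toc-substituted (ts-hit Ψ _) (here T) = [] , fo-var , T
  tsubst-toc-substituted (ts-lam ts) A with tsubst-toc-substituted ts (toc-shiftDs 0 A)
  ... | o , fo , T = d0 ∷ o , fo-lam fo , toc-lam T
  tsubst-toc-substituted (ts-app {Ψs₀ = Ψs₀} p ts tss) A with Any-++⁻ Ψs₀ (Any-resp-↭ p A)
  ... | inj₁ A₀ with tsubst-toc-substituted ts A₀
  ...   | o , fo , T = d0 ∷ o , fo-fun fo , toc-fun T
  tsubst-toc-substituted (ts-app p ts tss) A | inj₂ A₁ with tsubsts-toc-substituted tss A₁
  ...   | o , fo , T = d1 ∷ o , fo-arg fo , toc-arg T

  tsubsts-toc-substituted : ∀ {k u Ψs w q} {Χs : List (Der w)} {Χs'} → TSubstArgs k u Ψs Χs Χs' →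
                            Any (λ Ψ → InToc Ψ q) Ψs →
                            ∃[ o ] (FreeOcc k w o × Any (λ Χ → InToc Χ (o ++ q)) Χs')
  tsubsts-toc-substituted (_∷_ {Ψs₁ = Ψs₁} ts tss) A with Any-++⁻ Ψs₁ A
  ... | inj₁ A₀ with tsubst-toc-substituted ts A₀
  ...   | o , fo , T = o , fo , here T
  tsubsts-toc-substituted (ts ∷ tss) A | inj₂ A₁ with tsubsts-toc-substituted tss A₁
  ...   | o , fo , T = o , fo , there T

-- Subject reduction

record Reduct {t : Tm} (Φ : Der t) (p : Occ) (t' : Tm) : Set where
  constructor reduct
  field
    Φ'    : Der t'
    dred  : DRed Φ p Φ'
    valid : Valid Φ'
    ty-≅  : ty Φ' ≅ ty Φ
    ctx-≅ : ∀ j → ctx Φ' j ≅ₘ ctx Φ j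

record Reducts {u : Tm} (Ψs : List (Der u)) (p : Occ) (u' : Tm) : Set where
  constructor reducts
  field
    Ψs'   : List (Der u')
    dreds : Pointwise (λ Ψ Ψ' → DRed Ψ p Ψ') Ψs Ψs'
    valid : All Valid Ψs'
    ty-≅  : Pointwise (λ Ψ' Ψ → ty Ψ' ≅ ty Ψ) Ψs' Ψs
    ctx-≅ : ∀ j → ctxs Ψs' j ≅ₘ ctxs Ψs j

mutual
  subjectReduction : ∀ {t p t'} (Φ : Der t) → Valid Φ → Contract t p t' → Reduct Φ p t'
  subjectReduction (appE (val _) _ _) (v-app _ () _ _) here
  subjectReduction (appE (lamI Φ) v Ψs) (v-app (v-lam V) refl mM VΨs) here
    with substitute 0 v Ψs Φ V VΨs (≈M⇒≅ₘ mM)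
  ... | substitution Φ' ts V' t c = reduct Φ' (dr-β ts) V' t c
  subjectReduction (val b) _ (inLam c) = reduct (val _) (dr-val c) v-val ≅a (λ _ → [])
  subjectReduction (lamI Φ) (v-lam V) (inLam c) with subjectReduction Φ V c
  ... | reduct Φ' d V' t cx =
    reduct (lamI Φ') (dr-lam d) (v-lam V') (≅⇒ (cx 0) t) (λ j → cx (suc j))
  subjectReduction (appE Φ u Ψs) (v-app V e mM VΨs) (inFun c) with subjectReduction Φ V c
  ... | reduct Φ' d V' t cx with ≅-⇒-inv (subst (ty Φ' ≅_) e t)
  ...   | _ , _ , e' , mM' , _ =
    reduct (appE Φ' u Ψs) (dr-fun d) (v-app V' e' (≅ₘ⇒≈M (≅ₘ-trans mM' (≈M⇒≅ₘ mM))) VΨs)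
           (≅-cod t) (λ j → ≅ₘ-++ (cx j) (≅ₘ-refl _))
  subjectReduction (appE Φ u Ψs) (v-app V e mM VΨs) (inArg c) with subjectReductions Ψs VΨs c
  ... | reducts Ψs' ds VΨs' ts cs =
    reduct (appE Φ _ Ψs') (dr-arg c ds)
           (v-app V e (≅ₘ⇒≈M (≅ₘ-trans (≈M⇒≅ₘ mM) (≅ₘ-sym (Pointwise⇒≅ₘ ts)))) VΨs')
           (≅-refl _) (λ j → ≅ₘ-++ (≅ₘ-refl _) (cs j))

  subjectReductions : ∀ {u p u'} (Ψs : List (Der u)) → All Valid Ψs → Contract u p u' →
                      Reducts Ψs p u'
  subjectReductions []       []         c = reducts [] [] [] [] (λ _ → [])
  subjectReductions (Ψ ∷ Ψs) (V ∷ VΨs) c with subjectReduction Ψ V c | subjectReductions Ψs VΨs c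
  ... | reduct Ψ' d V' t cx | reducts Ψs' ds VΨs' ts cs =
    reducts (Ψ' ∷ Ψs') (d ∷ ds) (V' ∷ VΨs') (t ∷ ts) (λ j → ≅ₘ-++ (cx j) (cs j))

-- Redexes and their residuals

Prefix : Occ → Occ → Set
Prefix p r = ∃[ q ] (r ≡ p ++ q)

¬Prefix-tail : ∀ {d p r} → ¬ Prefix (d ∷ p) (d ∷ r) → ¬ Prefix p r
¬Prefix-tail np (q , e) = np (q , cong (_ ∷_) e)

_≟ᵈ_ : (a b : Dir) → Dec (a ≡ b)
d0 ≟ᵈ d0 = yes refl
d0 ≟ᵈ d1 = no λ ()
d1 ≟ᵈ d0 = no λ ()
d1 ≟ᵈ d1 = yes refl

prefix? : (p r : Occ) → Dec (Prefix p r)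
prefix? []      r       = yes (r , refl)
prefix? (_ ∷ _) []      = no λ { (_ , ()) }
prefix? (a ∷ p) (b ∷ r) with a ≟ᵈ b | prefix? p r
... | yes refl | yes (q , e) = yes (q , cong (a ∷_) e)
... | yes refl | no np       = no λ { (q , refl) → np (q , refl) }
... | no a≢b   | _           = no λ { (_ , refl) → a≢b refl }

at-++ : ∀ t p {w} q → t at p ≡ just w → t at (p ++ q) ≡ w at q
at-++ t         []       q refl = refl
at-++ (lam t)   (d0 ∷ p) q e    = at-++ t p q e
at-++ (app t u) (d0 ∷ p) q e    = at-++ t p q e
at-++ (app t u) (d1 ∷ p) q e    = at-++ u p q e
at-++ (var _)   (d0 ∷ _) q ()
at-++ (var _)   (d1 ∷ _) q ()
at-++ (lam _)   (d1 ∷ _) q ()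

redex-++⁺ : ∀ t p {w q} → t at p ≡ just w → IsRedexOcc w q → IsRedexOcc t (p ++ q)
redex-++⁺ t p {q = q} e (s , v , e') = s , v , trans (at-++ t p q e) e'

redex-++⁻ : ∀ t p {w q} → t at p ≡ just w → IsRedexOcc t (p ++ q) → IsRedexOcc w q
redex-++⁻ t p {q = q} e (s , v , e') = s , v , trans (sym (at-++ t p q e)) e'

contract-at : ∀ {t p t'} → Contract t p t' →
              ∃[ s ] ∃[ v ] (t at p ≡ just (app (lam s) v) × t' at p ≡ just (sub 0 v s))
contract-at here      = _ , _ , refl , refl
contract-at (inLam c) = contract-at c
contract-at (inFun c) = contract-at c
contract-at (inArg c) = contract-at c

data RedexBelow (s v : Tm) : Occ → Set where
  in-body : ∀ {q} → IsRedexOcc s q → RedexBelow s v (d0 ∷ d0 ∷ q)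
  in-arg  : ∀ {q} → IsRedexOcc v q → RedexBelow s v (d1 ∷ q)

redexBelow : ∀ {s v} q → q ≢ [] → IsRedexOcc (app (lam s) v) q → RedexBelow s v q
redexBelow []                 q≢[] _         = ⊥-elim (q≢[] refl)
redexBelow (d0 ∷ [])          _    (_ , _ , ())
redexBelow (d0 ∷ d1 ∷ _)      _    (_ , _ , ())
redexBelow (d0 ∷ d0 ∷ _)      _    R         = in-body R
redexBelow (d1 ∷ _)           _    R         = in-arg R

contract-redex-disjoint : ∀ {t p t' r} → Contract t p t' → IsRedexOcc t r → ¬ Prefix p r →
                          IsRedexOcc t' r
contract-redex-disjoint here _ np = ⊥-elim (np (_ , refl))
contract-redex-disjoint {r = []}     (inLam _) (_ , _ , ())
contract-redex-disjoint {r = d0 ∷ r} (inLam c) R np = contract-redex-disjoint c R (¬Prefix-tail np)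
contract-redex-disjoint {r = d1 ∷ r} (inLam _) (_ , _ , ())
contract-redex-disjoint {r = []}     (inFun (inLam _)) (_ , _ , refl) _ = _ , _ , refl
contract-redex-disjoint {r = d0 ∷ r} (inFun c) R np = contract-redex-disjoint c R (¬Prefix-tail np)
contract-redex-disjoint {r = d1 ∷ r} (inFun _) R _  = R
contract-redex-disjoint {r = []}     (inArg _) (_ , _ , refl) _ = _ , _ , refl
contract-redex-disjoint {r = d0 ∷ r} (inArg _) R _  = R
contract-redex-disjoint {r = d1 ∷ r} (inArg c) R np = contract-redex-disjoint c R (¬Prefix-tail np)

↑-redex : ∀ c u q → IsRedexOcc u q → IsRedexOcc (↑ c u) q
↑-redex c (app _ _) []       (_ , _ , refl) = _ , _ , refl
↑-redex c (lam u)   (d0 ∷ q) R              = ↑-redex (suc c) u q R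
↑-redex c (app u _) (d0 ∷ q) R              = ↑-redex c u q R
↑-redex c (app _ w) (d1 ∷ q) R              = ↑-redex c w q R
↑-redex c (var _)   []       (_ , _ , ())
↑-redex c (lam _)   []       (_ , _ , ())
↑-redex c (var _)   (_ ∷ _)  (_ , _ , ())
↑-redex c (lam _)   (d1 ∷ _) (_ , _ , ())

sub-redex : ∀ k u s q → IsRedexOcc s q → IsRedexOcc (sub k u s) q
sub-redex k u (app _ _) []       (_ , _ , refl) = _ , _ , refl
sub-redex k u (lam s)   (d0 ∷ q) R              = sub-redex (suc k) (↑ 0 u) s q R
sub-redex k u (app s _) (d0 ∷ q) R              = sub-redex k u s q R
sub-redex k u (app _ w) (d1 ∷ q) R              = sub-redex k u w q R
sub-redex k u (var _)   []       (_ , _ , ())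
sub-redex k u (lam _)   []       (_ , _ , ())
sub-redex k u (var _)   (_ ∷ _)  (_ , _ , ())
sub-redex k u (lam _)   (d1 ∷ _) (_ , _ , ())

sub-redex-at-freeOcc : ∀ {k s o} u q → FreeOcc k s o → IsRedexOcc u q →
                       IsRedexOcc (sub k u s) (o ++ q)
sub-redex-at-freeOcc {k} u q fo-var      R rewrite ≡ᵇ-refl k = R
sub-redex-at-freeOcc     u q (fo-lam fo) R = sub-redex-at-freeOcc (↑ 0 u) q fo (↑-redex 0 u q R)
sub-redex-at-freeOcc     u q (fo-fun fo) R = sub-redex-at-freeOcc u q fo R
sub-redex-at-freeOcc     u q (fo-arg fo) R = sub-redex-at-freeOcc u q fo R

mutual
  dred-toc-disjoint : ∀ {t t' p r} {Φ : Der t} {Φ' : Der t'} → DRed Φ p Φ' → InToc Φ r →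
                      ¬ Prefix p r → InToc Φ' r
  dred-toc-disjoint (dr-β _)      _           np = ⊥-elim (np (_ , refl))
  dred-toc-disjoint d             toc-root    _  = toc-root
  dred-toc-disjoint (dr-lam d)    (toc-lam T) np = toc-lam (dred-toc-disjoint d T (¬Prefix-tail np))
  dred-toc-disjoint (dr-fun d)    (toc-fun T) np = toc-fun (dred-toc-disjoint d T (¬Prefix-tail np))
  dred-toc-disjoint (dr-fun _)    (toc-arg A) _  = toc-arg A
  dred-toc-disjoint (dr-arg _ _)  (toc-fun T) _  = toc-fun T
  dred-toc-disjoint (dr-arg _ ds) (toc-arg A) np =
    toc-arg (dreds-toc-disjoint ds A (¬Prefix-tail np))

  dreds-toc-disjoint : ∀ {u u' p r} {Ψs : List (Der u)} {Ψs' : List (Der u')} →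
                       Pointwise (λ Ψ Ψ' → DRed Ψ p Ψ') Ψs Ψs' → Any (λ Ψ → InToc Ψ r) Ψs →
                       ¬ Prefix p r → Any (λ Ψ → InToc Ψ r) Ψs'
  dreds-toc-disjoint (d ∷ _)  (here T)  np = here (dred-toc-disjoint d T np)
  dreds-toc-disjoint (_ ∷ ds) (there A) np = there (dreds-toc-disjoint ds A np)

mutual
  dred-toc-body : ∀ {t t' p q} {Φ : Der t} {Φ' : Der t'} → DRed Φ p Φ' →
                  InToc Φ (p ++ d0 ∷ d0 ∷ q) → InToc Φ' (p ++ q)
  dred-toc-body (dr-β ts)     (toc-fun (toc-lam T)) = tsubst-toc ts T
  dred-toc-body (dr-lam d)    (toc-lam T)           = toc-lam (dred-toc-body d T)
  dred-toc-body (dr-fun d)    (toc-fun T)           = toc-fun (dred-toc-body d T)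
  dred-toc-body (dr-arg _ ds) (toc-arg A)           = toc-arg (dreds-toc-body ds A)

  dreds-toc-body : ∀ {u u' p q} {Ψs : List (Der u)} {Ψs' : List (Der u')} →
                   Pointwise (λ Ψ Ψ' → DRed Ψ p Ψ') Ψs Ψs' →
                   Any (λ Ψ → InToc Ψ (p ++ d0 ∷ d0 ∷ q)) Ψs → Any (λ Ψ → InToc Ψ (p ++ q)) Ψs'
  dreds-toc-body (d ∷ _)  (here T)  = here (dred-toc-body d T)
  dreds-toc-body (_ ∷ ds) (there A) = there (dreds-toc-body ds A)

ArgResidual : Tm → Occ → Occ → (Occ → Set) → Set
ArgResidual t p q P =
  ∃[ s ] ∃[ v ] ∃[ o ] (t at p ≡ just (app (lam s) v) × FreeOcc 0 s o × P (p ++ o ++ q))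

mutual
  dred-toc-arg : ∀ {t t' p q} {Φ : Der t} {Φ' : Der t'} → DRed Φ p Φ' →
                 InToc Φ (p ++ d1 ∷ q) → ArgResidual t p q (InToc Φ')
  dred-toc-arg (dr-β ts) (toc-arg A) with tsubst-toc-substituted ts A
  ... | o , fo , T = _ , _ , o , refl , fo , T
  dred-toc-arg (dr-lam d) (toc-lam T) with dred-toc-arg d T
  ... | s , v , o , e , fo , T' = s , v , o , e , fo , toc-lam T'
  dred-toc-arg (dr-fun d) (toc-fun T) with dred-toc-arg d T
  ... | s , v , o , e , fo , T' = s , v , o , e , fo , toc-fun T'
  dred-toc-arg (dr-arg _ ds) (toc-arg A) with dreds-toc-arg ds A
  ... | s , v , o , e , fo , A' = s , v , o , e , fo , toc-arg A'

  dreds-toc-arg : ∀ {u u' p q} {Ψs : List (Der u)} {Ψs' : List (Der u')} →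
                  Pointwise (λ Ψ Ψ' → DRed Ψ p Ψ') Ψs Ψs' → Any (λ Ψ → InToc Ψ (p ++ d1 ∷ q)) Ψs →
                  ArgResidual u p q (λ r → Any (λ Ψ → InToc Ψ r) Ψs')
  dreds-toc-arg (d ∷ _) (here T) with dred-toc-arg d T
  ... | s , v , o , e , fo , T' = s , v , o , e , fo , here T'
  dreds-toc-arg (_ ∷ ds) (there A) with dreds-toc-arg ds A
  ... | s , v , o , e , fo , A' = s , v , o , e , fo , there A'

record TypedResidual {t : Tm} (p r : Occ) {t' : Tm} (Φ' : Der t') : Set where
  constructor typed-residual
  field
    r'       : Occ
    residual : Residual t p r r'
    redex    : IsRedexOcc t' r'
    typed    : InToc Φ' r'

typedResidual : ∀ {t p t' r} {Φ : Der t} {Φ' : Der t'} → Contract t p t' → DRed Φ p Φ' →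
                IsRedexOcc t r → InToc Φ r → p ≢ r → TypedResidual {t} p r Φ'
typedResidual {t} {p} {t'} {r} c d R T p≢r with prefix? p r
... | no np =
  typed-residual r (res-out np) (contract-redex-disjoint c R np) (dred-toc-disjoint d T np)
... | yes (q , refl) with contract-at c
...   | s , v , e , e' with redexBelow q (λ { refl → p≢r (sym (++-identityʳ p)) }) (redex-++⁻ t p e R)
...     | in-body {q'} R' =
  typed-residual (p ++ q') res-body (redex-++⁺ t' p e' (sub-redex 0 v s q' R')) (dred-toc-body d T)
...     | in-arg {q'} R' with dred-toc-arg d T
...       | _ , _ , o , e₀ , fo , T' with trans (sym e₀) e
...         | refl = typed-residual (p ++ o ++ q') (res-arg e₀ fo)
                       (redex-++⁺ t' p e' (sub-redex-at-freeOcc v q' fo R')) T'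

-- Normal principal derivations type no redex

Normal : ∀ {t} → Der t → Set
Normal {t} Φ = ∀ {r} → InToc Φ r → ¬ IsRedexOcc t r

headType : ∀ {t} → Der t → Ty
headType (ax _ τ)     = τ
headType (appE Φ _ _) = headType Φ
headType _            = ⋆a

ctx-head : ∀ {t x n} → Spine t x n → (Φ : Der t) → ∃[ R ] (ctx Φ x ≡ headType Φ ∷ R)
ctx-head (sp-var {x}) (ax _ τ) rewrite ≡ᵇ-refl x = [] , refl
ctx-head (sp-app sp)  (appE Φ _ _) with ctx-head sp Φ
... | _ , e rewrite e = _ , refl

spine-app-not-redex : ∀ {t x n u} → Spine t x n → ¬ IsRedexOcc (app t u) []
spine-app-not-redex () (_ , _ , refl)

spine-normal : ∀ {t x n} → Spine t x n → (Φ : Der t) → Valid Φ → ∀ m α →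
               headType Φ ≅ arrows (n + m) α → ty Φ ≅ arrows m α × Normal Φ
spine-normal sp-var (ax _ _) _ m α h = h , λ { toc-root (_ , _ , ()) }
spine-normal (sp-app {n = n} sp) (appE Φ u Ψs) (v-app V e mM _) m α h
  with spine-normal sp Φ V (suc m) α (subst (λ k → headType Φ ≅ arrows k α) (sym (+-suc n m)) h)
... | tyΦ , normal with subst (_≅ arrows (suc m) α) e tyΦ
... | ≅⇒ M≅[] τ≅ with ≅ₘ-[]ʳ M≅[]
... | refl with ≅ₘ-map-ty-[] Ψs (≈M⇒≅ₘ mM)
... | refl = subst (λ ρ → cod ρ ≅ arrows m α) (sym e) τ≅ , normal-app
  where
  normal-app : Normal (appE Φ u [])
  normal-app toc-root    R = spine-app-not-redex sp R
  normal-app (toc-fun T) R = normal T R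
  normal-app (toc-arg ())

normalPrincipal⇒normal : ∀ {t} (Φ : Der t) → Valid Φ → NormalPrincipal Φ → Normal Φ
normalPrincipal⇒normal (val _)  _ (np-lam _ _)  toc-root (_ , _ , ())
normalPrincipal⇒normal (lamI _) _ (np-lam () _)
normalPrincipal⇒normal Φ V (np-neu {n = n} {α} sp _ ctx≅ _) with ctx-head sp Φ
... | _ , e with subst (_≅ₘ [ arrows n α ]) e (≈M⇒≅ₘ ctx≅)
... | cons h here _ =
  proj₂ (spine-normal sp Φ V 0 α (subst (λ k → headType Φ ≅ arrows k α) (sym (+-identityʳ n)) h))
... | cons _ (there ()) _

principallyTyped-step : ∀ {t t'} {Φ : Der t} {Φ' : Der t'} → DStep Φ Φ' →
                        PrincipallyTyped Φ → PrincipallyTyped Φ'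
principallyTyped-step s P Φ'' ds = P Φ'' (d-step s ds)

typedRedex-needed : ∀ {t u r} (Φ : Der t) → Valid Φ → PrincipallyTyped Φ →
                    IsRedexOcc t r → InToc Φ r → (σ : Steps t u) → WHNF u → Hits r σ
typedRedex-needed Φ V P R T done w = ⊥-elim (normalPrincipal⇒normal Φ V (P Φ d-done w) T R)
typedRedex-needed {r = r} Φ V P R T (step p c σ) w with ≡-dec _≟ᵈ_ p r
... | yes refl = hit-now
... | no p≢r with subjectReduction Φ V c
...   | reduct Φ' d V' _ _ with typedResidual c d R T p≢r
...     | typed-residual _ res R' T' =
  hit-later res (typedRedex-needed Φ' V' (principallyTyped-step (p , c , d) P) R' T' σ w)

mainTheorem4 : ∀ {t r} (Φ : Der t) → Valid Φ → WeakHeadNormalising t → PrincipallyTyped Φ →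
                 IsRedexOcc t r → InToc Φ r → WeakHeadNeeded t r
mainTheorem4 Φ V _ P R T σ = typedRedex-needed Φ V P R T σ
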